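{- Let $G$ be a finite connected graph and let $\mathcal{P}_0$ be the all-singleton partition of $E(G)$ (each edge is its own class). Then the binary quotient labeling $\lambda$ of $\mathcal{P}_0$ is isometric: $d_{\mathrm{Cay}}(\lambda(u),\lambda(v))=d_G(u,v)$ for all $u,v\in V(G)$.
   Context: $d_G$ is the shortest-path metric. For a partition $\{F_1,\dots,F_t\}$ of $E(G)$ and a cycle basis $B_1,\dots,B_c$ of $G$ (cycles whose edge sets form a basis over $\mathbb{F}_2$ of the cycle space), the cycle–class parity matrix is $A\in\mathbb{F}_2^{c\times t}$, $A[i,j]=|F_j\cap E(B_i)|\bmod 2$. The binary quotient labeling of the partition is obtained as follows: let $\pi\colon\mathbb{Z}_2^t\to\mathbb{Z}_2^t/\mathrm{rowspan}(A)\cong\mathbb{Z}_2^k$ be the quotient map, $g_j=\pi(e_j)$ for the standard basis vectors $e_j$, and $\lambda(v)=\sum_{e\in P(r,v)}g_{\mathrm{class}(e)}$ along any path $P(r,v)$ from a fixed root $r$ to $v$ (this is independent of the path), where $\mathrm{class}(e)=j$ if $e\in F_j$. The host is $\mathrm{Cay}(\mathbb{Z}_2^k,S)$ with $S=\{g_j:g_j\ne0\}$, the graph on $\mathbb{Z}_2^k$ with edges $\{h,h+s\}$, $s\in S$, and $d_{\mathrm{Cay}}$ is its graph metric. -}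

module Defs where

open import Algebra.Bundles.Raw using (RawMonoid; RawGroup)
import Algebra.Definitions.RawMonoid as RawMonoidDefs
open import Algebra.Morphism.Structures using (module GroupMorphisms)
open import Data.Bool.Base using (if_then_else_)
open import Data.Fin.Base using (Fin; _<_)
open import Data.Fin.Properties using (_≟_)
open import Data.Fin.Subset using (Subset; ⁅_⁆; _∩_; ⋃; ∣_∣)
open import Data.List.Base as List using (List; []; _∷_; foldr)
open import Data.List.Relation.Unary.Unique.Propositional using (Unique)
open import Data.Nat.Base using (ℕ; suc; _≤_; parity)
open import Data.Parity.Base as ℙ using (Parity; 0ℙ; 1ℙ)
open import Data.Product using (Σ; ∃-syntax; _×_; _,_; proj₁; proj₂)
open import Data.Sum using (_⊎_)
open import Data.Vec.Base as Vec using (Vec; tabulate; replicate; zipWith)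
open import Function.Base using (id; _∘_)
open import Function.Definitions using (Injective; StrictlySurjective)
open import Level using (0ℓ)
open import Relation.Binary.Construct.Closure.ReflexiveTransitive using (Star; ε; _◅_; fold)
open import Relation.Binary.Core using (Rel)
open import Relation.Binary.PropositionalEquality using (_≡_; _≢_; refl)
open import Relation.Nullary.Decidable using (does; _⊎-dec_)
open import Relation.Unary using (Pred; _∈_)

𝔽₂^_ : ℕ → Set
𝔽₂^ n = Vec Parity n

infixl 6 _⊕_
_⊕_ : ∀ {n} → 𝔽₂^ n → 𝔽₂^ n → 𝔽₂^ n
_⊕_ = zipWith ℙ._+_

𝟎 : ∀ {n} → 𝔽₂^ n
𝟎 = replicate _ 0ℙ

infixr 7 _·_
_·_ : ∀ {n} → Parity → 𝔽₂^ n → 𝔽₂^ n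
a · x = Vec.map (a ℙ.*_) x

⊕-rawMonoid : ℕ → RawMonoid 0ℓ 0ℓ
⊕-rawMonoid n = record { Carrier = 𝔽₂^ n ; _≈_ = _≡_ ; _∙_ = _⊕_ ; ε = 𝟎 }

-- Not `ℙ.+-0-rawGroup` componentwise: `ℙ._⁻¹` swaps the parities, whereas
-- the additive inverse in characteristic 2 is the identity.
⊕-rawGroup : ℕ → RawGroup 0ℓ 0ℓ
⊕-rawGroup n = record
  { Carrier = 𝔽₂^ n ; _≈_ = _≡_ ; _∙_ = _⊕_ ; ε = 𝟎 ; _⁻¹ = id }

lincomb : ∀ {c n} → (Fin c → Parity) → (Fin c → 𝔽₂^ n) → 𝔽₂^ n
lincomb {n = n} a b = RawMonoidDefs.sum (⊕-rawMonoid n) (λ i → a i · b i)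

Span : ∀ {c n} → (Fin c → 𝔽₂^ n) → Pred (𝔽₂^ n) 0ℓ
Span b x = ∃[ a ] lincomb a b ≡ x

LinearlyIndependent : ∀ {c n} → (Fin c → 𝔽₂^ n) → Set
LinearlyIndependent b = ∀ a → lincomb a b ≡ 𝟎 → ∀ i → a i ≡ 0ℙ

record IsBasis {c n} (b : Fin c → 𝔽₂^ n) (W : Pred (𝔽₂^ n) 0ℓ) : Set where
  field
    member      : ∀ i → b i ∈ W
    independent : LinearlyIndependent b
    spanning    : ∀ x → x ∈ W → x ∈ Span b

χ : ∀ {n} → Subset n → 𝔽₂^ n
χ = Vec.map (if_then 1ℙ else 0ℙ)

-- 𝔽₂^ t modulo W; two vectors are identified when their difference, which
-- over 𝔽₂ is their sum, lies in W.
_/_ : (t : ℕ) → Pred (𝔽₂^ t) 0ℓ → RawGroup 0ℓ 0ℓ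
t / W = record
  { Carrier = 𝔽₂^ t ; _≈_ = λ x y → (x ⊕ y) ∈ W ; _∙_ = _⊕_ ; ε = 𝟎 ; _⁻¹ = id }

-- An identification of 𝔽₂^ t / W with some 𝔽₂^ k. As t / W has carrier
-- 𝔽₂^ t, its underlying function π is the quotient map 𝔽₂^ t → 𝔽₂^ k.
record QuotientMap {t : ℕ} (W : Pred (𝔽₂^ t) 0ℓ) : Set where
  field
    k             : ℕ
    π             : 𝔽₂^ t → 𝔽₂^ k
    isIsomorphism : GroupMorphisms.IsGroupIsomorphism (t / W) (⊕-rawGroup k) π

module _ {V : Set} {_~_ : Rel V 0ℓ} where

  length : ∀ {u v} → Star _~_ u v → ℕ
  length = fold (λ _ _ → ℕ) (λ _ n → suc n) 0

  -- The sequence of vertices of a walk, without its final vertex.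
  sources : ∀ {u v} → Star _~_ u v → List V
  sources ε                 = []
  sources (_◅_ {i = u} _ p) = u ∷ sources p

  vertices : ∀ {u v} → Star _~_ u v → List V
  vertices {v = v} p = sources p List.∷ʳ v

record IsDistance {V : Set} (_~_ : Rel V 0ℓ) (u v : V) (d : ℕ) : Set where
  field
    attained : Σ (Star _~_ u v) λ p → length p ≡ d
    minimal  : (p : Star _~_ u v) → d ≤ length p

-- An edge is an unordered pair of distinct vertices, represented by its
-- increasingly ordered pair of ends.
record Graph : Set where
  field
    #V #E          : ℕ
    ends           : Fin #E → Fin #V × Fin #V
    ends-ordered   : ∀ e → proj₁ (ends e) < proj₂ (ends e)
    ends-injective : Injective _≡_ _≡_ ends

  V E : Set
  V = Fin #V
  E = Fin #E

  Adj : Rel V 0ℓ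
  Adj u v = ∃[ e ] (ends e ≡ (u , v) ⊎ ends e ≡ (v , u))

  Walk : Rel V 0ℓ
  Walk = Star Adj

  edges : ∀ {u v} → Walk u v → List E
  edges = fold (λ _ _ → List E) (λ s es → proj₁ s ∷ es) []

  edgeSet : ∀ {u v} → Walk u v → Subset #E
  edgeSet p = ⋃ (List.map ⁅_⁆ (edges p))

  Connected : Set
  Connected = ∀ u v → Walk u v

  record Path (u v : V) : Set where
    field
      walk     : Walk u v
      distinct : Unique (vertices walk)

  record Cycle : Set where
    field
      {base}   : V
      walk     : Walk base base
      long     : 3 ≤ length walk
      distinct : Unique (sources walk)

  star : V → Subset #E
  star v = tabulate λ e → does ((proj₁ (ends e) ≟ v) ⊎-dec (proj₂ (ends e) ≟ v))

  -- The characteristic vectors of the edge sets in which every vertex has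
  -- even degree.
  CycleSpace : Pred (𝔽₂^ #E) 0ℓ
  CycleSpace x = ∃[ X ] x ≡ χ X × (∀ v → parity ∣ star v ∩ X ∣ ≡ 0ℙ)

  record CycleBasis : Set where
    field
      c       : ℕ
      B       : Fin c → Cycle
      isBasis : IsBasis (λ i → χ (edgeSet (Cycle.walk (B i)))) CycleSpace

record Partition (m : ℕ) : Set where
  field
    t        : ℕ
    class    : Fin m → Fin t
    nonempty : StrictlySurjective _≡_ class

  F : Fin t → Subset m
  F j = tabulate λ e → does (class e ≟ j)

singletons : ∀ m → Partition m
singletons m = record { t = m ; class = id ; nonempty = λ e → e , refl }

module _ (G : Graph) where
  open Graph G
  open Partition

  parityMatrix : (𝓑 : CycleBasis) (𝓟 : Partition #E) →
                 Fin (CycleBasis.c 𝓑) → 𝔽₂^ (t 𝓟)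
  parityMatrix 𝓑 𝓟 i = tabulate λ j → parity ∣ F 𝓟 j ∩ edgeSet (Cycle.walk (B i)) ∣
    where open CycleBasis 𝓑

  RowSpan : (𝓑 : CycleBasis) (𝓟 : Partition #E) → Pred (𝔽₂^ (t 𝓟)) 0ℓ
  RowSpan 𝓑 𝓟 = Span (parityMatrix 𝓑 𝓟)

  module Labeling (𝓑 : CycleBasis) (𝓟 : Partition #E)
                  (Q : QuotientMap (RowSpan 𝓑 𝓟)) where
    open QuotientMap Q public using (k; π)

    g : Fin (t 𝓟) → 𝔽₂^ k
    g j = π (χ ⁅ j ⁆)

    S : Pred (𝔽₂^ k) 0ℓ
    S s = s ≢ 𝟎 × ∃[ j ] s ≡ g j

    labeling : {r : V} → (∀ v → Path r v) → V → 𝔽₂^ k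
    labeling P v =
      foldr _⊕_ 𝟎 (List.map (g ∘ class 𝓟) (edges (Path.walk (P v))))

-- Adjacency in Cay(𝔽₂^ k, S); symmetric because s ⊕ s ≡ 𝟎.
Cay : ∀ {k} → Pred (𝔽₂^ k) 0ℓ → Rel (𝔽₂^ k) 0ℓ
Cay S h h′ = ∃[ s ] s ∈ S × h′ ≡ h ⊕ s

{-# OPTIONS --safe #-}

-- For singleton classes the row span of the parity matrix is the whole cycle
-- space, i.e. the kernel of the boundary map ∂. Hence a walk in G is a walk in
-- the Cayley graph, and a walk in the Cayley graph between λ(u) and λ(v) is a
-- list of edges of G whose sum has boundary δ u + δ v. Such a list contains an
-- edge at u unless u = v; removing it moves u to the other end of that edge, so
-- the list contains the edges of a walk from u to v.

module Submission where

open import Defs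
open import Algebra.Morphism.Structures using (module GroupMorphisms)
open import Data.Bool.Base using (true; false; if_then_else_)
open import Data.Fin.Base using (Fin; zero; suc)
open import Data.Fin.Properties using (_≟_; any?; <⇒≢)
open import Data.Fin.Subset using (Subset; inside; outside; ⁅_⁆; _∩_; ∣_∣)
open import Data.List.Base as List using (List; []; _∷_)
open import Data.Nat.Base as ℕ using (ℕ; suc; _≤_; z≤n; s≤s; parity)
open import Data.Nat.Induction using (<-rec)
import Data.Nat.Properties as ℕₚ
open import Data.Parity.Base as ℙ using (Parity; 0ℙ; 1ℙ)
import Data.Parity.Properties as ℙₚ
open import Algebra.Properties.CommutativeSemigroup ℙₚ.+-commutativeSemigroup
  using (interchange; x∙yz≈y∙xz)
open import Data.Product using (Σ; ∃-syntax; _×_; _,_; proj₁; proj₂)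
open import Data.Product.Properties using (≡-dec)
open import Data.Sum using (inj₁; inj₂)
open import Data.Vec.Base as Vec using ([]; _∷_; tabulate; lookup)
open import Data.Vec.Properties
  using (tabulate-cong; tabulate∘lookup; lookup∘tabulate; zipWith-assoc; zipWith-identityʳ)
open import Function.Base using (_∘_)
open import Level using (0ℓ)
open import Relation.Binary.Construct.Closure.ReflexiveTransitive using (Star; ε; _◅_; gmap)
open import Relation.Binary.Core using (Rel)
open import Relation.Binary.PropositionalEquality
open import Relation.Nullary using (Dec; yes; no; does; contradiction)
open import Relation.Nullary.Decidable using (map′; _×-dec_; _⊎-dec_; dec-true; dec-false)
open import Relation.Unary using (Decidable)

open ≡-Reasoning

private variable
  c n : ℕ

-- Least witnesses and arithmetic in `𝔽₂^ n`.

least : {P : ℕ → Set} → Decidable P → ∀ n → P n →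
        ∃[ d ] P d × (∀ i → P i → d ≤ i)
least {P} P? = <-rec _ step
  where
  step : ∀ n → (∀ {i} → i ℕ.< n → P i → ∃[ d ] P d × (∀ i → P i → d ≤ i)) →
         P n → ∃[ d ] P d × (∀ i → P i → d ≤ i)
  step n rec Pn with ℕₚ.anyUpTo? P? n
  ... | yes (i , i<n , Pi) = rec i<n Pi
  ... | no none = n , Pn , λ i Pi → ℕₚ.≮⇒≥ λ i<n → none (i , i<n , Pi)

⊕-assoc : (x y z : 𝔽₂^ n) → (x ⊕ y) ⊕ z ≡ x ⊕ (y ⊕ z)
⊕-assoc = zipWith-assoc ℙₚ.+-assoc

+-cancel-self : ∀ p q → p ℙ.+ (p ℙ.+ q) ≡ q
+-cancel-self p q = trans (sym (ℙₚ.+-assoc p p q)) (cong (ℙ._+ q) (ℙₚ.p+p≡0ℙ p))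

⊕-cancel-self : (x y : 𝔽₂^ n) → x ⊕ (x ⊕ y) ≡ y
⊕-cancel-self [] [] = refl
⊕-cancel-self (p ∷ x) (q ∷ y) = cong₂ _∷_ (+-cancel-self p q) (⊕-cancel-self x y)

⊕-identityʳ : (x : 𝔽₂^ n) → x ⊕ 𝟎 ≡ x
⊕-identityʳ = zipWith-identityʳ ℙₚ.+-identityʳ

lincomb-cong : (a : Fin c → Parity) {b b′ : Fin c → 𝔽₂^ n} →
               (∀ i → b i ≡ b′ i) → lincomb a b ≡ lincomb a b′
lincomb-cong {ℕ.zero} a eq = refl
lincomb-cong {suc c} a eq =
  cong₂ _⊕_ (cong (a zero ·_) (eq zero)) (lincomb-cong (a ∘ suc) (eq ∘ suc))

χ-surjective : (x : 𝔽₂^ n) → ∃[ X ] x ≡ χ X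
χ-surjective [] = [] , refl
χ-surjective (0ℙ ∷ x) = let X , eq = χ-surjective x in outside ∷ X , cong (0ℙ ∷_) eq
χ-surjective (1ℙ ∷ x) = let X , eq = χ-surjective x in inside ∷ X , cong (1ℙ ∷_) eq

-- Parity sums over a subset, as linear functionals.

sumOver : Subset n → 𝔽₂^ n → Parity
sumOver [] [] = 0ℙ
sumOver (inside ∷ A) (p ∷ x) = p ℙ.+ sumOver A x
sumOver (outside ∷ A) (_ ∷ x) = sumOver A x

sumOver-⊕ : (A : Subset n) (x y : 𝔽₂^ n) →
            sumOver A (x ⊕ y) ≡ sumOver A x ℙ.+ sumOver A y
sumOver-⊕ [] [] [] = refl
sumOver-⊕ (inside ∷ A) (p ∷ x) (q ∷ y) =
  trans (cong (p ℙ.+ q ℙ.+_) (sumOver-⊕ A x y)) (interchange p q _ _)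
sumOver-⊕ (outside ∷ A) (_ ∷ x) (_ ∷ y) = sumOver-⊕ A x y

sumOver-𝟎 : (A : Subset n) → sumOver A 𝟎 ≡ 0ℙ
sumOver-𝟎 [] = refl
sumOver-𝟎 (inside ∷ A) = sumOver-𝟎 A
sumOver-𝟎 (outside ∷ A) = sumOver-𝟎 A

sumOver-· : (A : Subset n) (a : Parity) (x : 𝔽₂^ n) →
            sumOver A (a · x) ≡ a ℙ.* sumOver A x
sumOver-· [] a [] = sym (ℙₚ.*-zeroʳ a)
sumOver-· (inside ∷ A) a (p ∷ x) =
  trans (cong (a ℙ.* p ℙ.+_) (sumOver-· A a x)) (sym (ℙₚ.*-distribˡ-+ a p _))
sumOver-· (outside ∷ A) a (_ ∷ x) = sumOver-· A a x

sumOver-lincomb : (A : Subset n) (a : Fin c → Parity) (b : Fin c → 𝔽₂^ n) →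
                  (∀ i → sumOver A (b i) ≡ 0ℙ) → sumOver A (lincomb a b) ≡ 0ℙ
sumOver-lincomb {c = ℕ.zero} A a b b≡0 = sumOver-𝟎 A
sumOver-lincomb {c = suc c} A a b b≡0 = begin
  sumOver A (a zero · b zero ⊕ rest)
    ≡⟨ sumOver-⊕ A (a zero · b zero) rest ⟩
  sumOver A (a zero · b zero) ℙ.+ sumOver A rest
    ≡⟨ cong₂ ℙ._+_ (sumOver-· A (a zero) (b zero))
                   (sumOver-lincomb A (a ∘ suc) (b ∘ suc) (b≡0 ∘ suc)) ⟩
  a zero ℙ.* sumOver A (b zero) ℙ.+ 0ℙ
    ≡⟨ ℙₚ.+-identityʳ _ ⟩
  a zero ℙ.* sumOver A (b zero)
    ≡⟨ cong (a zero ℙ.*_) (b≡0 zero) ⟩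
  a zero ℙ.* 0ℙ
    ≡⟨ ℙₚ.*-zeroʳ (a zero) ⟩
  0ℙ ∎
  where rest = lincomb (a ∘ suc) (b ∘ suc)

-- Turns the cardinalities in `CycleSpace` and `parityMatrix` into values of a linear functional, so
-- that both can be treated by linear algebra.
parity-∩ : (A X : Subset n) → parity ∣ A ∩ X ∣ ≡ sumOver A (χ X)
parity-∩ [] [] = refl
parity-∩ (inside ∷ A) (inside ∷ X) =
  trans (ℙₚ.+-homo-+ 1 ∣ A ∩ X ∣) (cong ℙ._⁻¹ (parity-∩ A X))
parity-∩ (inside ∷ A) (outside ∷ X) = parity-∩ A X
parity-∩ (outside ∷ A) (_ ∷ X) = parity-∩ A X

sumOver-⊥ : (x : 𝔽₂^ n) → sumOver (tabulate λ _ → outside) x ≡ 0ℙ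
sumOver-⊥ [] = refl
sumOver-⊥ (_ ∷ x) = sumOver-⊥ x

sumOver-class : (j : Fin n) (x : 𝔽₂^ n) →
                sumOver (Partition.F (singletons n) j) x ≡ lookup x j
sumOver-class zero (p ∷ x) = trans (cong (p ℙ.+_) (sumOver-⊥ x)) (ℙₚ.+-identityʳ p)
sumOver-class (suc j) (_ ∷ x) = sumOver-class j x

sumOver-⁅⁆ : (A : Subset n) (e : Fin n) →
             sumOver A (χ ⁅ e ⁆) ≡ (if lookup A e then 1ℙ else 0ℙ)
sumOver-⁅⁆ (a ∷ A) zero = head a
  where
  χ-⊥ : ∀ n → χ (Vec.replicate n outside) ≡ 𝟎
  χ-⊥ ℕ.zero = refl
  χ-⊥ (suc n) = cong (0ℙ ∷_) (χ-⊥ n)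
  tail : sumOver A (χ (Vec.replicate _ outside)) ≡ 0ℙ
  tail = trans (cong (sumOver A) (χ-⊥ _)) (sumOver-𝟎 A)
  head : ∀ a → sumOver (a ∷ A) (χ ⁅ zero ⁆) ≡ (if a then 1ℙ else 0ℙ)
  head true = cong ℙ._⁻¹ tail
  head false = tail
sumOver-⁅⁆ (inside ∷ A) (suc e) = sumOver-⁅⁆ A e
sumOver-⁅⁆ (outside ∷ A) (suc e) = sumOver-⁅⁆ A e

-- A list rather than a subset: repeated edges cancel in the sum but still count towards the length,
-- as steps of a Cayley walk do.
sum⁅_⁆ : List (Fin n) → 𝔽₂^ n
sum⁅ [] ⁆ = 𝟎
sum⁅ e ∷ L ⁆ = χ ⁅ e ⁆ ⊕ sum⁅ L ⁆

δ : Fin n → Fin n → Parity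
δ u v = if does (u ≟ v) then 1ℙ else 0ℙ

δ-refl : (u : Fin n) → δ u u ≡ 1ℙ
δ-refl u = cong (if_then 1ℙ else 0ℙ) (dec-true (u ≟ u) refl)

δ-≢ : {u v : Fin n} → u ≢ v → δ u v ≡ 0ℙ
δ-≢ {u = u} {v} u≢v = cong (if_then 1ℙ else 0ℙ) (dec-false (u ≟ v) u≢v)

-- The boundary map over the two-element field.

module Boundary (G : Graph) where
  open Graph G

  ∂ : 𝔽₂^ #E → V → Parity
  ∂ x v = sumOver (star v) x

  ∂-⊕ : ∀ x y v → ∂ (x ⊕ y) v ≡ ∂ x v ℙ.+ ∂ y v
  ∂-⊕ x y v = sumOver-⊕ (star v) x y

  -- The kernel of `∂`. Being a record, it lets `x` be inferred from the type, which the bare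
  -- equations would not; likewise for `Joins`.
  record Closed (x : 𝔽₂^ #E) : Set where
    constructor closed
    field boundary : ∀ v → ∂ x v ≡ 0ℙ

  -- The boundary of a walk from `u` to `v`. For `u ≡ v` the two terms cancel, so closed sums need
  -- no separate treatment.
  record Joins (x : 𝔽₂^ #E) (u v : V) : Set where
    constructor joins
    field boundary : ∀ w → ∂ x w ≡ δ u w ℙ.+ δ v w

  Joins-refl : ∀ {u} → Joins 𝟎 u u
  Joins-refl {u} = joins λ w → trans (sumOver-𝟎 (star w)) (sym (ℙₚ.p+p≡0ℙ (δ u w)))

  Joins-sym : ∀ {x u v} → Joins x u v → Joins x v u
  Joins-sym {u = u} {v} (joins xuv) =
    joins λ w → trans (xuv w) (ℙₚ.+-comm (δ u w) (δ v w))

  Joins-trans : ∀ {x y u v w} → Joins x u v → Joins y v w → Joins (x ⊕ y) u w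
  Joins-trans {x} {y} {u} {v} {w} (joins xuv) (joins yvw) = joins λ z → begin
    ∂ (x ⊕ y) z                                 ≡⟨ ∂-⊕ x y z ⟩
    ∂ x z ℙ.+ ∂ y z                             ≡⟨ cong₂ ℙ._+_ (xuv z) (yvw z) ⟩
    (δ u z ℙ.+ δ v z) ℙ.+ (δ v z ℙ.+ δ w z)     ≡⟨ cancel (δ u z) (δ v z) (δ w z) ⟩
    δ u z ℙ.+ δ w z                             ∎
    where
    cancel : ∀ p q r → (p ℙ.+ q) ℙ.+ (q ℙ.+ r) ≡ p ℙ.+ r
    cancel p q r = trans (ℙₚ.+-assoc p q _) (cong (p ℙ.+_) (+-cancel-self q r))

  Joins-cancelˡ : ∀ {x y u v w} → Joins x u w → Joins (x ⊕ y) u v → Joins y w v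
  Joins-cancelˡ {x} {y} {v = v} {w} xuw xyuv =
    subst (λ z → Joins z w v) (⊕-cancel-self x y) (Joins-trans (Joins-sym xuw) xyuv)

  Joins⇒Closed : ∀ {x v} → Joins x v v → Closed x
  Joins⇒Closed {v = v} (joins xvv) = closed λ w → trans (xvv w) (ℙₚ.p+p≡0ℙ (δ v w))

  Closed⇒Joins : ∀ {x v} → Closed x → Joins x v v
  Closed⇒Joins {v = v} (closed x≡0) =
    joins λ w → trans (x≡0 w) (sym (ℙₚ.p+p≡0ℙ (δ v w)))

  Joins-incident : ∀ {x u v} → u ≢ v → Joins x u v → ∂ x u ≡ 1ℙ
  Joins-incident {u = u} {v} u≢v (joins xuv) =
    trans (xuv u) (cong₂ ℙ._+_ (δ-refl u) (δ-≢ (u≢v ∘ sym)))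

  ∂-⁅⁆ : ∀ e v → ∂ (χ ⁅ e ⁆) v ≡ δ (proj₁ (ends e)) v ℙ.+ δ (proj₂ (ends e)) v
  ∂-⁅⁆ e v =
    trans (sumOver-⁅⁆ (star v) e)
      (trans (cong (if_then 1ℙ else 0ℙ) (lookup∘tabulate _ e))
             (disjoint (proj₁ (ends e) ≟ v) (proj₂ (ends e) ≟ v)))
    where
    disjoint : (p : Dec (proj₁ (ends e) ≡ v)) (q : Dec (proj₂ (ends e) ≡ v)) →
               (if does (p ⊎-dec q) then 1ℙ else 0ℙ) ≡
               (if does p then 1ℙ else 0ℙ) ℙ.+ (if does q then 1ℙ else 0ℙ)
    -- An edge has distinct ends, so the disjunction defining `star` is exclusive and agrees with
    -- the sum of parities.
    disjoint (yes a≡v) (yes b≡v) = contradiction (trans a≡v (sym b≡v)) (<⇒≢ (ends-ordered e))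
    disjoint (yes _) (no _) = refl
    disjoint (no _) (yes _) = refl
    disjoint (no _) (no _) = refl

  Joins-Adj : ∀ {u v} (s : Adj u v) → Joins (χ ⁅ proj₁ s ⁆) u v
  Joins-Adj (e , inj₁ refl) = joins (∂-⁅⁆ e)
  Joins-Adj (e , inj₂ refl) = Joins-sym (joins (∂-⁅⁆ e))

  Joins-Walk : ∀ {u v} (p : Walk u v) → Joins sum⁅ edges p ⁆ u v
  Joins-Walk ε = Joins-refl
  Joins-Walk (s ◅ p) = Joins-trans (Joins-Adj s) (Joins-Walk p)

  -- From edge lists to walks.

  incident⇒Adj : ∀ {e u} → ∂ (χ ⁅ e ⁆) u ≡ 1ℙ → ∃[ w ] Σ (Adj u w) λ s → proj₁ s ≡ e
  incident⇒Adj {e} {u} inc with proj₁ (ends e) ≟ u | proj₂ (ends e) ≟ u | ∂-⁅⁆ e u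
  ... | yes refl | _ | _ = _ , (e , inj₁ refl) , refl
  ... | no _ | yes refl | _ = _ , (e , inj₂ refl) , refl
  ... | no _ | no _ | ∂≡0 with () ← trans (sym ∂≡0) inc

  -- The boundary at `u` is a sum of parities, so if it is odd, some edge of the list contributes
  -- `1ℙ`. Comparing boundaries instead of vectors reduces the rearrangement to commutativity of
  -- parities.
  remove-incident : ∀ L {u} → ∂ sum⁅ L ⁆ u ≡ 1ℙ →
    ∃[ e ] ∃[ L′ ] ∂ (χ ⁅ e ⁆) u ≡ 1ℙ × List.length L ≡ suc (List.length L′) ×
    (∀ w → ∂ sum⁅ L ⁆ w ≡ ∂ (χ ⁅ e ⁆ ⊕ sum⁅ L′ ⁆) w)
  remove-incident [] {u} inc with () ← trans (sym (sumOver-𝟎 (star u))) inc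
  remove-incident (e ∷ L) {u} inc with ∂ (χ ⁅ e ⁆) u in eq
  ... | 1ℙ = e , L , eq , refl , λ _ → refl
  ... | 0ℙ with f , L′ , inc′ , len , split ← remove-incident L
                 (trans (sym (trans (∂-⊕ (χ ⁅ e ⁆) sum⁅ L ⁆ u) (cong (ℙ._+ ∂ sum⁅ L ⁆ u) eq))) inc)
    = f , e ∷ L′ , inc′ , cong suc len , λ w → begin
      ∂ (χ ⁅ e ⁆ ⊕ sum⁅ L ⁆) w
        ≡⟨ ∂-⊕ (χ ⁅ e ⁆) _ w ⟩
      ∂ (χ ⁅ e ⁆) w ℙ.+ ∂ sum⁅ L ⁆ w
        ≡⟨ cong (∂ (χ ⁅ e ⁆) w ℙ.+_) (trans (split w) (∂-⊕ (χ ⁅ f ⁆) _ w)) ⟩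
      ∂ (χ ⁅ e ⁆) w ℙ.+ (∂ (χ ⁅ f ⁆) w ℙ.+ ∂ sum⁅ L′ ⁆ w)
        ≡⟨ x∙yz≈y∙xz (∂ (χ ⁅ e ⁆) w) (∂ (χ ⁅ f ⁆) w) (∂ sum⁅ L′ ⁆ w) ⟩
      ∂ (χ ⁅ f ⁆) w ℙ.+ (∂ (χ ⁅ e ⁆) w ℙ.+ ∂ sum⁅ L′ ⁆ w)
        ≡⟨ cong (∂ (χ ⁅ f ⁆) w ℙ.+_) (∂-⊕ (χ ⁅ e ⁆) _ w) ⟨
      ∂ (χ ⁅ f ⁆) w ℙ.+ ∂ (χ ⁅ e ⁆ ⊕ sum⁅ L′ ⁆) w
        ≡⟨ ∂-⊕ (χ ⁅ f ⁆) _ w ⟨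
      ∂ (χ ⁅ f ⁆ ⊕ (χ ⁅ e ⁆ ⊕ sum⁅ L′ ⁆)) w ∎

  Joins⇒Walk : ∀ n L {u v} → List.length L ≡ n → Joins sum⁅ L ⁆ u v →
               Σ (Walk u v) λ p → length p ≤ n
  Joins⇒Walk n L {u} {v} len Luv with u ≟ v
  -- Edges still in the list have closed sum and are discarded; hence only a bound on the length,
  -- not an equality.
  ... | yes refl = ε , z≤n
  ... | no u≢v with remove-incident L (Joins-incident u≢v Luv)
  Joins⇒Walk ℕ.zero L len Luv | no _ | _ , _ , _ , len′ , _
    with () ← trans (sym len) len′
  Joins⇒Walk (suc n) L {u} {v} len Luv | no _ | e , L′ , inc , len′ , split
    with w , s , refl ← incident⇒Adj inc
    with p , p≤n ← Joins⇒Walk n L′ {w} {v} (ℕₚ.suc-injective (trans (sym len′) len))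
           -- Cancelling the edge from `u` to `w` leaves `L′` joining `w` to `v`.
           (Joins-cancelˡ (Joins-Adj s) (joins λ z → trans (sym (split z)) (Joins.boundary Luv z)))
    = s ◅ p , s≤s p≤n

  -- Existence of distances in a connected graph.

  walkOfLength? : ∀ n u v → Dec (Σ (Walk u v) λ p → length p ≡ n)
  walkOfLength? ℕ.zero u v =
    map′ (λ { refl → ε , refl }) (λ { (ε , _) → refl }) (u ≟ v)
  walkOfLength? (suc n) u v =
    map′ (λ { (w , s , p , len) → s ◅ p , cong suc len })
         (λ { (s ◅ p , len) → _ , s , p , ℕₚ.suc-injective len })
         (any? λ w → adj? u w ×-dec walkOfLength? n w v)
    where
    adj? : ∀ u w → Dec (Adj u w)
    adj? u w = any? λ e → ≡-dec _≟_ _≟_ (ends e) (u , w) ⊎-dec ≡-dec _≟_ _≟_ (ends e) (w , u)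

  -- Walks of a given length are decidable, so the length of any connecting walk can be lowered to
  -- the least one.
  distance : Connected → ∀ u v → ∃[ d ] IsDistance Adj u v d
  distance connected u v =
    let d , attained , minimal = least (λ n → walkOfLength? n u v) _ (connected u v , refl)
    in d , record { attained = attained ; minimal = λ p → minimal _ (p , refl) }

length-gmap : {A B : Set} {R : Rel A 0ℓ} {T : Rel B 0ℓ} (f : A → B)
              (step : ∀ {x y} → R x y → T (f x) (f y)) →
              ∀ {x y} (p : Star R x y) → length (gmap {U = T} f step p) ≡ length p
length-gmap f step ε = refl
length-gmap f step (s ◅ p) = cong suc (length-gmap f step p)

-- The labeling of the singleton partition.

module SingletonLabeling
  (G : Graph) (𝓑 : Graph.CycleBasis G)
  (Q : QuotientMap (RowSpan G 𝓑 (singletons (Graph.#E G))))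
  {r : Graph.V G} (P : ∀ v → Graph.Path G r v)
  where

  open Graph G
  open Labeling G 𝓑 (singletons #E) Q
  open Boundary G
  open CycleBasis 𝓑
  open IsBasis isBasis
  open GroupMorphisms.IsGroupIsomorphism (QuotientMap.isIsomorphism Q)
    using (∙-homo; ε-homo; ⟦⟧-cong; injective)

  W : 𝔽₂^ #E → Set
  W = RowSpan G 𝓑 (singletons #E)

  -- Class `j` consists of the edge `j` alone, so the parity entry at `j` is the `j`-th coordinate
  -- of the cycle.
  row≡cycle : ∀ i → parityMatrix G 𝓑 (singletons #E) i ≡ χ (edgeSet (Cycle.walk (B i)))
  row≡cycle i = trans
    (tabulate-cong λ j → trans (parity-∩ (Partition.F (singletons #E) j) X) (sumOver-class j (χ X)))
    (tabulate∘lookup (χ X))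
    where X = edgeSet (Cycle.walk (B i))

  -- Closed vectors are those of the cycle space, which the basis cycles, that is, the rows, span.
  Closed⇒W : ∀ {x} → Closed x → W x
  Closed⇒W {x} (closed x≡0) =
    let X , x≡χX = χ-surjective x
        a , eq = spanning x (X , x≡χX , λ v →
          trans (parity-∩ (star v) X) (trans (cong (sumOver (star v)) (sym x≡χX)) (x≡0 v)))
    in a , trans (lincomb-cong a row≡cycle) eq

  -- Each row is a basis cycle and hence has even degrees, a property that linear combinations
  -- inherit.
  W⇒Closed : ∀ {x} → W x → Closed x
  W⇒Closed (a , refl) = closed λ v → sumOver-lincomb (star v) a _ λ i →
    let X , eq , even = member i
    in trans (cong (sumOver (star v)) (trans (row≡cycle i) eq))
             (trans (sym (parity-∩ (star v) X)) (even v))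

  pathSum : V → 𝔽₂^ #E
  pathSum v = sum⁅ edges (Path.walk (P v)) ⁆

  pathSum-Joins : ∀ v → Joins (pathSum v) r v
  pathSum-Joins v = Joins-Walk (Path.walk (P v))

  labeling≡π : ∀ v → labeling P v ≡ π (pathSum v)
  labeling≡π v = go (edges (Path.walk (P v)))
    where
    go : ∀ L → List.foldr _⊕_ 𝟎 (List.map g L) ≡ π sum⁅ L ⁆
    go [] = sym ε-homo
    go (e ∷ L) = trans (cong (g e ⊕_) (go L)) (sym (∙-homo (χ ⁅ e ⁆) sum⁅ L ⁆))

  labeling-⊕ : ∀ u x → labeling P u ⊕ π x ≡ π (pathSum u ⊕ x)
  labeling-⊕ u x = trans (cong (_⊕ π x) (labeling≡π u)) (sym (∙-homo (pathSum u) x))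

  -- Going along `x` and back to `v` through the root is closed, hence lies in `W` and is killed by
  -- `π`.
  Joins⇒labeling : ∀ {x u v} → Joins x u v → labeling P v ≡ labeling P u ⊕ π x
  Joins⇒labeling {x} {u} {v} xuv =
    trans (labeling≡π v)
      (trans (⟦⟧-cong (Closed⇒W (Joins⇒Closed loop))) (sym (labeling-⊕ u x)))
    where
    loop : Joins (pathSum v ⊕ (pathSum u ⊕ x)) v v
    loop = Joins-trans (Joins-sym (pathSum-Joins v)) (Joins-trans (pathSum-Joins u) xuv)

  labeling⇒Joins : ∀ {x u v} → labeling P v ≡ labeling P u ⊕ π x → Joins x u v
  labeling⇒Joins {x} {u} {v} eq =
    -- The closed sum is read as joining `r` to itself; cancelling both root paths in turn leaves
    -- `x` between `u` and `v`.
    Joins-cancelˡ (pathSum-Joins u)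
      (Joins-sym (Joins-cancelˡ (pathSum-Joins v) (Closed⇒Joins loop)))
    where
    loop : Closed (pathSum v ⊕ (pathSum u ⊕ x))
    loop = W⇒Closed (injective (trans (sym (labeling≡π v)) (trans eq (labeling-⊕ u x))))

  -- A single edge has odd boundary at its ends, so it is not closed and survives in the quotient.
  -- Thus every edge gives a generator in `S`.
  g≢𝟎 : ∀ e → g e ≢ 𝟎
  g≢𝟎 e ge≡𝟎 =
    contradiction (trans (sym odd) (Closed.boundary even (proj₁ (ends e)))) λ ()
    where
    odd : ∂ (χ ⁅ e ⁆) (proj₁ (ends e)) ≡ 1ℙ
    odd = Joins-incident (<⇒≢ (ends-ordered e)) (joins (∂-⁅⁆ e))
    even : Closed (χ ⁅ e ⁆)
    even = subst Closed (⊕-identityʳ (χ ⁅ e ⁆)) (W⇒Closed (injective (trans ge≡𝟎 (sym ε-homo))))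

  -- Comparison of walks in the graph and in the Cayley graph.

  Adj⇒Cay : ∀ {u v} → Adj u v → Cay S (labeling P u) (labeling P v)
  Adj⇒Cay s = g (proj₁ s) , (g≢𝟎 (proj₁ s) , proj₁ s , refl) , Joins⇒labeling (Joins-Adj s)

  -- Every generator is `g e` for some edge `e`; choosing one per step gives the list. Consecutive
  -- edges need not meet in the graph.
  Cay⇒edges : ∀ {h h′} (q : Star (Cay S) h h′) →
              ∃[ L ] List.length L ≡ length q × h′ ≡ h ⊕ π sum⁅ L ⁆
  Cay⇒edges {h} ε = [] , refl , sym (trans (cong (h ⊕_) ε-homo) (⊕-identityʳ h))
  Cay⇒edges {h} ((_ , (_ , e , refl) , refl) ◅ q) with L , len , refl ← Cay⇒edges q =
    e ∷ L , cong suc len ,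
    trans (⊕-assoc h (g e) _) (cong (h ⊕_) (sym (∙-homo (χ ⁅ e ⁆) sum⁅ L ⁆)))

  isometric : ∀ {u v d} → IsDistance Adj u v d →
              IsDistance (Cay S) (labeling P u) (labeling P v) d
  isometric {u} {v} {d} dist = record
    { attained = let p , len = attained in
        -- A shortest walk maps to a Cayley walk of the same length.
        gmap (labeling P) Adj⇒Cay p , trans (length-gmap (labeling P) Adj⇒Cay p) len
    ; minimal = λ q →
        let L , len , eq = Cay⇒edges q
            -- The edges read off `q` contain those of a walk in the graph, so `q` is at least as
            -- long as that walk.
            p , p≤q = Joins⇒Walk (length q) L len (labeling⇒Joins eq)
        in ℕₚ.≤-trans (minimal p) p≤q
    }
    where open IsDistance dist

lemma3 : (G : Graph) → let open Graph G in
    Connected →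
    (𝓑 : CycleBasis) (Q : QuotientMap (RowSpan G 𝓑 (singletons #E))) →
    let open Labeling G 𝓑 (singletons #E) Q in
    (r : V) (P : ∀ v → Path r v) →
    ∀ u v → ∃[ d ] IsDistance (Cay S) (labeling P u) (labeling P v) d × IsDistance Adj u v d
lemma3 G connected 𝓑 Q r P u v =
  let d , dist = Boundary.distance G connected u v
  in d , SingletonLabeling.isometric G 𝓑 Q P dist , dist
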